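{- For every integer $d\ge 0$, $$E_d^+ = \sum_{k=0}^d H_{d-2k}\,E_{k^2},$$ where $H_i=E_i=0$ for $i<0$. Here $k^2$ denotes the block of degree $k$ and multiplicity $2$ (not exponentiation).
   Context: Let $x_{i,j}$ ($i,j\ge 1$) be indeterminates with $\deg x_{i,j}=i$; all series have rational coefficients. A monomial is square-free if every exponent is at most $1$. For $d\ge 0$: $H_d$ is the sum of all monomials of degree $d$; $E^+_d$ is the sum of all square-free monomials of degree $d$; $E_d$ is the sum over square-free monomials $f$ of degree $d$ of $(-1)^{m(f)}f$, where $m(f)$ is the number of indeterminates in $f$. In particular $H_0=E_0=E_0^+=1$. For $k\ge 0$, $E_{k^2}$ is the series obtained from $E_k$ by replacing each $x_{i,j}$ by $x_{i,j}^2$ (so $E_{0^2}=1$). -}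

module Defs where

open import Algebra.Definitions.RawSemiring using (_^_)
open import Data.Bool.Base using (if_then_else_)
open import Data.Integer.Base using (ℤ; +_; -[1+_])
open import Data.List.Base as List using (List; []; _∷_; cartesianProductWith; foldr; upTo)
open import Data.List.Fresh as Fresh using (List#; []; cons; _#_)
open import Data.List.Fresh.Relation.Unary.All using (All; []; _∷_; all?)
open import Data.Nat.Base using (ℕ; zero; suc; _+_; _*_; _∸_; _<_; _≤_; ⌊_/2⌋)
open import Data.Nat.Divisibility using (_∣_; _∣?_)
open import Data.Nat.Properties using (_≟_; _≤?_)
open import Data.Product.Base using (_×_; _,_)
open import Data.Product.Relation.Binary.Lex.Strict using (×-Lex)
open import Data.Rational.Base as ℚ using (ℚ; 0ℚ; 1ℚ; +-*-rawSemiring)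
open import Function.Base using (id; _on_)
open import Relation.Binary.PropositionalEquality using (_≡_)
open import Relation.Nullary.Decidable using (Dec; does; _×-dec_)

-- x[1+ i ,1+ j ] is the indeterminate x_{i+1,j+1}: both indices are positive.
record Indeterminate : Set where
  constructor x[1+_,1+_]
  field
    i j : ℕ

-- v ^1+ e is the power v^{e+1}: exponents occurring in a monomial are positive.
infix 7 _^1+_
record Power : Set where
  constructor _^1+_
  field
    base : Indeterminate
    e    : ℕ

exponent : Power → ℕ
exponent (_ ^1+ e) = suc e

powerDegree : Power → ℕ
powerDegree (x[1+ i ,1+ _ ] ^1+ e) = suc i * suc e

_≺_ : Power → Power → Set
_≺_ = ×-Lex _≡_ _<_ _<_ on λ (x[1+ i ,1+ j ] ^1+ _) → i , j

-- Powers of distinct indeterminates, in strictly increasing lexicographic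
-- order of the indices, so that each monomial has exactly one representation.
-- Indeterminates that are not listed have exponent 0.
Monomial : Set
Monomial = List# Power _≺_

degree : Monomial → ℕ
degree []           = 0
degree (cons p m _) = powerDegree p + degree m

SquareFree : Monomial → Set
SquareFree = All (λ p → exponent p ≤ 1)

squareFree? : (m : Monomial) → Dec (SquareFree m)
squareFree? = all? (λ p → exponent p ≤? 1)

numIndeterminates : Monomial → ℕ
numIndeterminates = Fresh.length

-- New exponents, possibly 0, for the indeterminates that occur in m.
Exponents : Monomial → Set
Exponents = All (λ _ → ℕ)

reweight   : (m : Monomial) → Exponents m → Monomial
reweight-# : ∀ {v a b} (m : Monomial) (es : Exponents m) →
             (v ^1+ a) # m → (v ^1+ b) # reweight m es

reweight []                      []           = []
reweight (cons _ m _)            (zero ∷ es)  = reweight m es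
reweight (cons (v ^1+ _) m v#m)  (suc e ∷ es) =
  cons (v ^1+ e) (reweight m es) (reweight-# m es v#m)

reweight-# []           []           _           = _
reweight-# (cons _ m _) (zero ∷ es)  (_   , v#m) = reweight-# m es v#m
reweight-# (cons _ m _) (suc e ∷ es) (v≺w , v#m) = v≺w , reweight-# m es v#m

splits : ℕ → List (ℕ × ℕ)
splits n = List.map (λ a → a , n ∸ a) (upTo (suc n))

-- All ordered pairs (a , b) of monomials with a b = m, each exactly once and
-- given by its exponents at the indeterminates of m.
factorizations : (m : Monomial) → List (Exponents m × Exponents m)
factorizations []           = ([] , []) ∷ []
factorizations (cons p m _) =
  cartesianProductWith (λ (a , b) (as , bs) → a ∷ as , b ∷ bs)
    (splits (exponent p)) (factorizations m)

-- A formal power series, as the function giving the coefficient of each monomial.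
Series : Set
Series = Monomial → ℚ

infix 4 _≈_
_≈_ : Series → Series → Set
F ≈ G = ∀ m → F m ≡ G m

∑ : List ℚ → ℚ
∑ = foldr ℚ._+_ 0ℚ

∑[k≤_] : ℕ → (ℕ → Series) → Series
∑[k≤ d ] F m = ∑ (List.map (λ k → F k m) (upTo (suc d)))

infixl 7 _·_
_·_ : Series → Series → Series
(F · G) m =
  ∑ (List.map (λ (as , bs) → F (reweight m as) ℚ.* G (reweight m bs))
              (factorizations m))

halve : Monomial → Monomial
halve = Fresh.map (λ (v ^1+ e) → v ^1+ ⌊ e /2⌋) id

-- The result of replacing each indeterminate by its square.  The coefficient of
-- m is that of its square root if all exponents of m are even, and 0 otherwise;
-- if e + 1 is even then (e + 1) / 2 = ⌊ e / 2 ⌋ + 1, as used by halve.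
_⟨x²⟩ : Series → Series
(F ⟨x²⟩) m =
  if does (all? (λ p → 2 ∣? exponent p) m) then F (halve m) else 0ℚ

H : ℤ → Series
H (+ d)    m = if does (degree m ≟ d) then 1ℚ else 0ℚ
H -[1+ _ ] m = 0ℚ

E⁺ : ℕ → Series
E⁺ d m = if does (squareFree? m ×-dec (degree m ≟ d)) then 1ℚ else 0ℚ

sign : ℕ → ℚ
sign n = _^_ +-*-rawSemiring (ℚ.- 1ℚ) n

E : ℤ → Series
E (+ d)    m =
  if does (squareFree? m ×-dec (degree m ≟ d)) then sign (numIndeterminates m) else 0ℚ
E -[1+ _ ] m = 0ℚ

-- E_{k²}: the block of degree k and multiplicity 2.
E² : ℕ → Series
E² k = E (+ k) ⟨x²⟩

-- Let W be the series ∏ (1 - x²) over all indeterminates x. Then E_{k²} is the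
-- part of W of degree 2k, and H_i that of ∏ (1 + x + x² + ⋯) of degree i, so the
-- right-hand side is the part of degree d of the product of the two series. That
-- product is ∏ (1 + x): at every indeterminate of m with exponent e ≥ 1 the
-- coefficients of 1 - x² up to x^e sum to 1 if e = 1 and to 0 if e ≥ 2.
{-# OPTIONS --safe #-}
module Submission where

open import Defs
open import Algebra.Bundles using (module CommutativeMonoid)
open import Algebra.Properties.CommutativeSemigroup using (interchange; x∙yz≈y∙xz)
open import Data.Bool.Base using (Bool; true; false; if_then_else_; _∧_)
open import Data.Bool.Properties using (if-eta; if-float)
open import Data.Integer.Base using (+_; _-_; _⊖_)
open import Data.Integer.Properties using (m-n≡m⊖n; [1+m]⊖[1+n]≡m⊖n)
open import Data.List.Base as List
  using (List; []; _∷_; _++_; applyUpTo; cartesianProductWith; upTo)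
open import Data.List.Fresh using ([]; cons)
open import Data.List.Fresh.Relation.Unary.All using ([]; _∷_; all?)
open import Data.List.Properties using (map-++; map-∘; map-cong; map-cong-local; map-upTo)
open import Data.List.Relation.Unary.All as All using (All; []; _∷_)
open import Data.List.Relation.Unary.All.Properties using (applyUpTo⁺₁; cartesianProductWith⁺; map⁺)
open import Data.Nat.Base using (ℕ; zero; suc; _+_; _*_; _∸_; _≡ᵇ_; _<ᵇ_; s≤s)
import Data.Nat.Properties as ℕₚ
open import Data.Nat.Divisibility using (_∣?_)
open import Data.Product.Base using (_,_; proj₂)
open import Data.Rational.Base as ℚ using (ℚ; 0ℚ; 1ℚ)
import Data.Rational.Properties as ℚₚ
open import Data.Sum.Base using (_⊎_; inj₁; inj₂)
open import Function.Base using (_∘_)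
open import Relation.Binary.PropositionalEquality
open import Relation.Nullary.Decidable using (does; yes; no; dec-false; dec-true)
open CommutativeMonoid using (commutativeSemigroup)
open ≡-Reasoning

private
  variable
    A B C : Set

-- Finite sums of rationals and indicator factors.

⟦_⟧ : Bool → ℚ
⟦ b ⟧ = if b then 1ℚ else 0ℚ

∑-zero : (xs : List A) → ∑ (List.map (λ _ → 0ℚ) xs) ≡ 0ℚ
∑-zero []       = refl
∑-zero (_ ∷ xs) = trans (ℚₚ.+-identityˡ _) (∑-zero xs)

∑-+ : (f g : A → ℚ) (xs : List A) →
      ∑ (List.map (λ x → f x ℚ.+ g x) xs) ≡ ∑ (List.map f xs) ℚ.+ ∑ (List.map g xs)
∑-+ f g []       = refl
∑-+ f g (x ∷ xs) = trans (cong (f x ℚ.+ g x ℚ.+_) (∑-+ f g xs))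
  (interchange (commutativeSemigroup ℚₚ.+-0-commutativeMonoid) (f x) (g x) _ _)

∑-*ˡ : (c : ℚ) (f : A → ℚ) (xs : List A) →
       ∑ (List.map (λ x → c ℚ.* f x) xs) ≡ c ℚ.* ∑ (List.map f xs)
∑-*ˡ c f []       = sym (ℚₚ.*-zeroʳ c)
∑-*ˡ c f (x ∷ xs) = trans (cong (c ℚ.* f x ℚ.+_) (∑-*ˡ c f xs))
  (sym (ℚₚ.*-distribˡ-+ c (f x) _))

∑-++ : (xs ys : List ℚ) → ∑ (xs ++ ys) ≡ ∑ xs ℚ.+ ∑ ys
∑-++ []       ys = sym (ℚₚ.+-identityˡ _)
∑-++ (x ∷ xs) ys = trans (cong (x ℚ.+_) (∑-++ xs ys)) (sym (ℚₚ.+-assoc x _ _))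

∑-swap : (f : A → B → ℚ) (xs : List A) (ys : List B) →
         ∑ (List.map (λ x → ∑ (List.map (f x) ys)) xs) ≡
         ∑ (List.map (λ y → ∑ (List.map (λ x → f x y) xs)) ys)
∑-swap f []       ys = sym (∑-zero ys)
∑-swap f (x ∷ xs) ys = trans (cong (∑ (List.map (f x) ys) ℚ.+_) (∑-swap f xs ys))
  (sym (∑-+ (f x) _ ys))

-- The distributive law. The `factorizations` of a nonempty monomial form such a product list, so a
-- sum over them splits off the factor of one indeterminate.
∑-cartesianProductWith :
  (f : A → B → C) (h : C → ℚ) (g : A → ℚ) (k : B → ℚ) →
  (∀ x y → h (f x y) ≡ g x ℚ.* k y) → (xs : List A) (ys : List B) →
  ∑ (List.map h (cartesianProductWith f xs ys)) ≡
  ∑ (List.map g xs) ℚ.* ∑ (List.map k ys)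
∑-cartesianProductWith f h g k eq []       ys = sym (ℚₚ.*-zeroˡ (∑ (List.map k ys)))
∑-cartesianProductWith f h g k eq (x ∷ xs) ys = begin
  ∑ (List.map h (List.map (f x) ys ++ zs))
    ≡⟨ cong ∑ (map-++ h (List.map (f x) ys) zs) ⟩
  ∑ (List.map h (List.map (f x) ys) ++ List.map h zs)
    ≡⟨ ∑-++ (List.map h (List.map (f x) ys)) _ ⟩
  ∑ (List.map h (List.map (f x) ys)) ℚ.+ ∑ (List.map h zs)
    ≡⟨ cong₂ ℚ._+_ row (∑-cartesianProductWith f h g k eq xs ys) ⟩
  g x ℚ.* ∑ (List.map k ys) ℚ.+ ∑ (List.map g xs) ℚ.* ∑ (List.map k ys)
    ≡⟨ ℚₚ.*-distribʳ-+ (∑ (List.map k ys)) (g x) _ ⟨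
  (g x ℚ.+ ∑ (List.map g xs)) ℚ.* ∑ (List.map k ys) ∎
  where
  zs = cartesianProductWith f xs ys
  row : ∑ (List.map h (List.map (f x) ys)) ≡ g x ℚ.* ∑ (List.map k ys)
  row = begin
    ∑ (List.map h (List.map (f x) ys))  ≡⟨ cong ∑ (map-∘ ys) ⟨
    ∑ (List.map (h ∘ f x) ys)           ≡⟨ cong ∑ (map-cong (eq x) ys) ⟩
    ∑ (List.map (λ y → g x ℚ.* k y) ys) ≡⟨ ∑-*ˡ (g x) k ys ⟩
    g x ℚ.* ∑ (List.map k ys)           ∎

-- After passing to `applyUpTo`, the tail of the sum is the same sum for `g ∘ suc`, which allows
-- induction on `j` and `n` together. The bracket on the right records whether the index `j` is in
-- range.
∑-δ : (j : ℕ) (g : ℕ → ℚ) (n : ℕ) →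
      ∑ (List.map (λ k → ⟦ j ≡ᵇ k ⟧ ℚ.* g k) (upTo n)) ≡ ⟦ j <ᵇ n ⟧ ℚ.* g j
∑-δ j g n = trans (cong ∑ (map-upTo _ n)) (go j g n)
  where
  zeros : (g : ℕ → ℚ) (n : ℕ) → ∑ (applyUpTo (λ k → 0ℚ ℚ.* g k) n) ≡ 0ℚ
  zeros g zero    = refl
  zeros g (suc n) = cong₂ ℚ._+_ (ℚₚ.*-zeroˡ (g 0)) (zeros (g ∘ suc) n)

  go : (j : ℕ) (g : ℕ → ℚ) (n : ℕ) →
       ∑ (applyUpTo (λ k → ⟦ j ≡ᵇ k ⟧ ℚ.* g k) n) ≡ ⟦ j <ᵇ n ⟧ ℚ.* g j
  go zero    g zero    = sym (ℚₚ.*-zeroˡ (g 0))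
  go (suc j) g zero    = sym (ℚₚ.*-zeroˡ (g (suc j)))
  go zero    g (suc n) = trans (cong (1ℚ ℚ.* g 0 ℚ.+_) (zeros (g ∘ suc) n)) (ℚₚ.+-identityʳ _)
  go (suc j) g (suc n) = trans (cong₂ ℚ._+_ (ℚₚ.*-zeroˡ (g 0)) (go j (g ∘ suc) n)) (ℚₚ.+-identityˡ _)

-- The series ∏ (1 - x²) and its link to `E²`.

-- The coefficients of 1 - x².
w : ℕ → ℚ
w 0 = 1ℚ
w 2 = ℚ.- 1ℚ
w _ = 0ℚ

-- Indeterminates not listed have exponent 0 and contribute `w 0`, that is 1, so the product over
-- the listed powers is the whole coefficient.
W : Series
W []           = 1ℚ
W (cons p m _) = w (exponent p) ℚ.* W m

halfDegree : Monomial → ℕ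
halfDegree m = degree (halve m)

-- The right-hand side is `E² k m` stripped of its degree test. Both sides vanish unless every
-- exponent is 2, and each exponent 2 contributes a factor -1.
W-as-sign : ∀ m → W m ≡
  (if does (all? (λ p → 2 ∣? exponent p) m)
   then if does (squareFree? (halve m)) then sign (numIndeterminates (halve m)) else 0ℚ
   else 0ℚ)
W-as-sign []                             = refl
W-as-sign (cons (_ ^1+ 0) m _)           = ℚₚ.*-zeroˡ (W m)
W-as-sign (cons (_ ^1+ 1) m _)           = begin
  ℚ.- 1ℚ ℚ.* W m
    ≡⟨ cong (ℚ.- 1ℚ ℚ.*_) (W-as-sign m) ⟩
  ℚ.- 1ℚ ℚ.* (if even then if sqfree then s else 0ℚ else 0ℚ)
    ≡⟨ if-float (ℚ.- 1ℚ ℚ.*_) even ⟩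
  (if even then ℚ.- 1ℚ ℚ.* (if sqfree then s else 0ℚ) else 0ℚ)
    ≡⟨ cong (λ q → if even then q else 0ℚ) (if-float (ℚ.- 1ℚ ℚ.*_) sqfree) ⟩
  (if even then if sqfree then ℚ.- 1ℚ ℚ.* s else 0ℚ else 0ℚ) ∎
  where
  even   = does (all? (λ p → 2 ∣? exponent p) m)
  sqfree = does (squareFree? (halve m))
  s      = sign (numIndeterminates (halve m))
-- Exponents from 3 on: the halved exponent is at least 2, so the square-free test fails and both
-- branches of the outer conditional are 0.
W-as-sign (cons (_ ^1+ suc (suc e)) m _) =
  trans (ℚₚ.*-zeroˡ (W m))
    (sym (if-eta (does (2 ∣? suc (suc (suc e))) ∧ does (all? (λ p → 2 ∣? exponent p) m))))

E²-as-W : ∀ k m → E² k m ≡ ⟦ halfDegree m ≡ᵇ k ⟧ ℚ.* W m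
E²-as-W k m = trans
  (cases (does (all? (λ p → 2 ∣? exponent p) m)) (does (squareFree? (halve m)))
         (halfDegree m ≡ᵇ k) (sign (numIndeterminates (halve m))))
  (cong (⟦ halfDegree m ≡ᵇ k ⟧ ℚ.*_) (sym (W-as-sign m)))
  where
  cases : ∀ even sqfree deg s →
    (if even then if sqfree ∧ deg then s else 0ℚ else 0ℚ) ≡
    ⟦ deg ⟧ ℚ.* (if even then if sqfree then s else 0ℚ else 0ℚ)
  cases false sqfree deg   s = sym (ℚₚ.*-zeroʳ ⟦ deg ⟧)
  cases true  false  deg   s = sym (ℚₚ.*-zeroʳ ⟦ deg ⟧)
  cases true  true   false s = sym (ℚₚ.*-zeroˡ s)
  cases true  true   true  s = sym (ℚₚ.*-identityˡ s)

-- `halve` rounds odd exponents up, so doubling recovers the degree only when all exponents are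
-- even; otherwise `W m` vanishes.
W≡0⊎even : ∀ m → W m ≡ 0ℚ ⊎ 2 * halfDegree m ≡ degree m
W≡0⊎even []                                         = inj₂ refl
W≡0⊎even (cons (_ ^1+ 0) m _)                       = inj₁ (ℚₚ.*-zeroˡ (W m))
W≡0⊎even (cons (_ ^1+ suc (suc _)) m _)             = inj₁ (ℚₚ.*-zeroˡ (W m))
W≡0⊎even (cons (x[1+ i ,1+ _ ] ^1+ 1) m _) with W≡0⊎even m
... | inj₁ Wm≡0 = inj₁ (trans (cong (ℚ.- 1ℚ ℚ.*_) Wm≡0) (ℚₚ.*-zeroʳ (ℚ.- 1ℚ)))
... | inj₂ eq   = inj₂ (begin
  2 * (suc i * 1 + halfDegree m)       ≡⟨ ℕₚ.*-distribˡ-+ 2 (suc i * 1) (halfDegree m) ⟩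
  2 * (suc i * 1) + 2 * halfDegree m   ≡⟨ cong₂ _+_ (cong (2 *_) (ℕₚ.*-identityʳ (suc i))) eq ⟩
  2 * suc i + degree m                 ≡⟨ cong (_+ degree m) (ℕₚ.*-comm 2 (suc i)) ⟩
  suc i * 2 + degree m                 ∎)

-- Sums over the factorizations of a monomial.

W-reweight : ∀ p m {p#m} e (es : Exponents m) →
  W (reweight (cons p m p#m) (e ∷ es)) ≡ w e ℚ.* W (reweight m es)
W-reweight p m zero    es = sym (ℚₚ.*-identityˡ _)
W-reweight p m (suc e) es = refl

degree-reweight : ∀ i j a m {p#m} e (es : Exponents m) →
  degree (reweight (cons (x[1+ i ,1+ j ] ^1+ a) m p#m) (e ∷ es)) ≡
  suc i * e + degree (reweight m es)
degree-reweight i j a m zero    es = cong (_+ degree (reweight m es)) (sym (ℕₚ.*-zeroʳ (suc i)))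
degree-reweight i j a m (suc e) es = refl

-- The entries of `upTo (suc n)` are at most `n`, so the truncated subtraction in `splits` is exact.
splits-sum : ∀ n → All (λ (a , b) → a + b ≡ n) (splits n)
splits-sum n = map⁺ (applyUpTo⁺₁ (λ a → a) (suc n) λ { (s≤s i≤n) → ℕₚ.m+[n∸m]≡n i≤n })

-- At each indeterminate the two exponents add up to the given one, and the degree is linear in the
-- exponents.
factorizations-degree : ∀ m →
  All (λ (as , bs) → degree (reweight m as) + degree (reweight m bs) ≡ degree m) (factorizations m)
factorizations-degree []           = refl ∷ []
factorizations-degree (cons p@(x[1+ i ,1+ j ] ^1+ e) m p#m) =
  cartesianProductWith⁺ (setoid _) (setoid _) (λ (a , b) (as , bs) → a ∷ as , b ∷ bs)
    (splits (suc e)) (factorizations m) λ {(a , b)} {(as , bs)} x∈ y∈ →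
    step a b as bs (All.lookup (splits-sum (suc e)) x∈) (All.lookup (factorizations-degree m) y∈)
  where
  step : ∀ a b as bs → a + b ≡ suc e →
    degree (reweight m as) + degree (reweight m bs) ≡ degree m →
    degree (reweight (cons p m p#m) (a ∷ as)) + degree (reweight (cons p m p#m) (b ∷ bs)) ≡
    suc i * suc e + degree m
  step a b as bs a+b≡ das+dbs≡ = begin
    degree (reweight (cons p m p#m) (a ∷ as)) + degree (reweight (cons p m p#m) (b ∷ bs))
      ≡⟨ cong₂ _+_ (degree-reweight i j e m a as) (degree-reweight i j e m b bs) ⟩
    (suc i * a + degree (reweight m as)) + (suc i * b + degree (reweight m bs))
      ≡⟨ interchange ℕₚ.+-commutativeSemigroup (suc i * a) _ _ _ ⟩
    (suc i * a + suc i * b) + (degree (reweight m as) + degree (reweight m bs))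
      ≡⟨ cong₂ _+_ (sym (ℕₚ.*-distribˡ-+ (suc i) a b)) das+dbs≡ ⟩
    suc i * (a + b) + degree m
      ≡⟨ cong (λ n → suc i * n + degree m) a+b≡ ⟩
    suc i * suc e + degree m ∎

∑-w : ∀ e → ∑ (List.map (w ∘ proj₂) (splits (suc e))) ≡ ⟦ does (suc e ℕₚ.≤? 1) ⟧
∑-w e = begin
  ∑ (List.map (w ∘ proj₂) (splits (suc e)))
    ≡⟨ cong ∑ (map-∘ {g = w ∘ proj₂} {f = λ a → a , suc e ∸ a} (upTo (suc (suc e)))) ⟨
  ∑ (List.map (λ a → w (suc e ∸ a)) (upTo (suc (suc e))))
    ≡⟨ cong ∑ (map-upTo (λ a → w (suc e ∸ a)) (suc (suc e))) ⟩
  ∑ (applyUpTo (λ a → w (suc e ∸ a)) (suc (suc e)))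
    ≡⟨ go e ⟩
  ⟦ does (suc e ℕₚ.≤? 1) ⟧ ∎
  where
  go : ∀ e → ∑ (applyUpTo (λ a → w (suc e ∸ a)) (suc (suc e))) ≡ ⟦ does (suc e ℕₚ.≤? 1) ⟧
  go 0             = refl
  go 1             = refl
  -- The sum starts at the top coefficient, as `suc e ∸ a` falls when `a` grows. From exponent 3 on
  -- this coefficient is 0 and is dropped, down to -1 + 0 + 1 = 0 at exponent 2.
  go (suc (suc e)) = trans (ℚₚ.+-identityˡ _) (go (suc e))

⟦⟧-∧ : ∀ a b → ⟦ a ∧ b ⟧ ≡ ⟦ a ⟧ ℚ.* ⟦ b ⟧
⟦⟧-∧ false b = sym (ℚₚ.*-zeroˡ ⟦ b ⟧)
⟦⟧-∧ true  b = sym (ℚₚ.*-identityˡ ⟦ b ⟧)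

-- All coefficients of ∏ (1 + x + x² + ⋯) are 1, so this is the coefficient of its product with `W`,
-- computed one indeterminate at a time.
∑-W : ∀ m → ∑ (List.map (λ (as , bs) → W (reweight m bs)) (factorizations m)) ≡
            ⟦ does (squareFree? m) ⟧
∑-W []           = refl
∑-W (cons p@(_ ^1+ e) m p#m) = begin
  ∑ (List.map (λ (as , bs) → W (reweight (cons p m p#m) bs)) (factorizations (cons p m p#m)))
    ≡⟨ ∑-cartesianProductWith _ _ (w ∘ proj₂) (λ (as , bs) → W (reweight m bs))
         (λ (_ , b) (_ , bs) → W-reweight p m b bs) (splits (suc e)) (factorizations m) ⟩
  ∑ (List.map (w ∘ proj₂) (splits (suc e))) ℚ.*
  ∑ (List.map (λ (as , bs) → W (reweight m bs)) (factorizations m))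
    ≡⟨ cong₂ ℚ._*_ (∑-w e) (∑-W m) ⟩
  ⟦ does (suc e ℕₚ.≤? 1) ⟧ ℚ.* ⟦ does (squareFree? m) ⟧
    ≡⟨ ⟦⟧-∧ (does (suc e ℕₚ.≤? 1)) _ ⟨
  ⟦ does (squareFree? (cons p m p#m)) ⟧ ∎

-- Degree tests and the sum over `k`.

H-difference : ∀ d n m → H (+ d - + n) m ≡ ⟦ degree m + n ≡ᵇ d ⟧
H-difference d n m = trans (cong (λ i → H i m) (m-n≡m⊖n d n)) (go d n)
  where
  go : ∀ d n → H (d ⊖ n) m ≡ ⟦ degree m + n ≡ᵇ d ⟧
  go zero    zero    rewrite ℕₚ.+-identityʳ (degree m)    = refl
  go (suc d) zero    rewrite ℕₚ.+-identityʳ (degree m)    = refl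
  -- Here the index is negative, where `H` is 0 by convention; the test fails too, as a successor is
  -- never 0.
  go zero    (suc n) rewrite ℕₚ.+-suc (degree m) n        = refl
  go (suc d) (suc n) rewrite ℕₚ.+-suc (degree m) n | [1+m]⊖[1+n]≡m⊖n d n = go d n

-- The bound k ≤ d on the summation index loses nothing: if deg a + 2k = d, then k ≤ d.
bound-redundant : ∀ d n k → ⟦ k <ᵇ suc d ⟧ ℚ.* ⟦ n + 2 * k ≡ᵇ d ⟧ ≡ ⟦ n + 2 * k ≡ᵇ d ⟧
bound-redundant d n k with n + 2 * k ℕₚ.≟ d
... | no  ≢d   rewrite dec-false (n + 2 * k ℕₚ.≟ d) ≢d = ℚₚ.*-zeroʳ ⟦ k <ᵇ suc d ⟧
... | yes refl rewrite dec-true (n + 2 * k ℕₚ.≟ n + 2 * k) refl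
                       | dec-true (k ℕₚ.<? suc (n + 2 * k))
                           (s≤s (ℕₚ.≤-trans (ℕₚ.m≤m+n k (k + 0)) (ℕₚ.m≤n+m (2 * k) n))) = refl

-- By its indicator factor, `E² k b` can be nonzero only for `k = halfDegree b`. Only this term
-- survives, and what remains is a test of the degree of the product of `a` and `b`.
∑-H*E² : ∀ d a b →
  ∑ (List.map (λ k → H (+ d - + (2 * k)) a ℚ.* E² k b) (upTo (suc d))) ≡
  ⟦ degree a + degree b ≡ᵇ d ⟧ ℚ.* W b
∑-H*E² d a b = begin
  ∑ (List.map (λ k → H (+ d - + (2 * k)) a ℚ.* E² k b) (upTo (suc d)))
    ≡⟨ cong ∑ (map-cong rearrange (upTo (suc d))) ⟩
  ∑ (List.map (λ k → ⟦ h ≡ᵇ k ⟧ ℚ.* (⟦ degree a + 2 * k ≡ᵇ d ⟧ ℚ.* W b)) (upTo (suc d)))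
    ≡⟨ ∑-δ h _ (suc d) ⟩
  ⟦ h <ᵇ suc d ⟧ ℚ.* (⟦ degree a + 2 * h ≡ᵇ d ⟧ ℚ.* W b)
    ≡⟨ ℚₚ.*-assoc ⟦ h <ᵇ suc d ⟧ _ (W b) ⟨
  ⟦ h <ᵇ suc d ⟧ ℚ.* ⟦ degree a + 2 * h ≡ᵇ d ⟧ ℚ.* W b
    ≡⟨ cong (ℚ._* W b) (bound-redundant d (degree a) h) ⟩
  ⟦ degree a + 2 * h ≡ᵇ d ⟧ ℚ.* W b
    ≡⟨ double ⟩
  ⟦ degree a + degree b ≡ᵇ d ⟧ ℚ.* W b ∎
  where
  h = halfDegree b

  rearrange : ∀ k → H (+ d - + (2 * k)) a ℚ.* E² k b ≡
                    ⟦ h ≡ᵇ k ⟧ ℚ.* (⟦ degree a + 2 * k ≡ᵇ d ⟧ ℚ.* W b)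
  rearrange k = trans (cong₂ ℚ._*_ (H-difference d (2 * k) a) (E²-as-W k b))
    (x∙yz≈y∙xz (commutativeSemigroup ℚₚ.*-1-commutativeMonoid) ⟦ degree a + 2 * k ≡ᵇ d ⟧ ⟦ h ≡ᵇ k ⟧ (W b))

  -- `2 * h` may differ from `degree b`, but only when `W b` is 0.
  double : ⟦ degree a + 2 * h ≡ᵇ d ⟧ ℚ.* W b ≡ ⟦ degree a + degree b ≡ᵇ d ⟧ ℚ.* W b
  double with W≡0⊎even b
  ... | inj₂ eq   = cong (λ n → ⟦ degree a + n ≡ᵇ d ⟧ ℚ.* W b) eq
  ... | inj₁ Wb≡0 = trans (vanish (degree a + 2 * h)) (sym (vanish (degree a + degree b)))
    where
    vanish : ∀ n → ⟦ n ≡ᵇ d ⟧ ℚ.* W b ≡ 0ℚ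
    vanish n = trans (cong (⟦ n ≡ᵇ d ⟧ ℚ.*_) Wb≡0) (ℚₚ.*-zeroʳ ⟦ n ≡ᵇ d ⟧)

proposition23 : (d : ℕ) → E⁺ d ≈ ∑[k≤ d ] (λ k → H (+ d - + (2 * k)) · E² k)
proposition23 d m = sym (begin
  (∑[k≤ d ] (λ k → H (+ d - + (2 * k)) · E² k)) m
    -- The sum over `k` moves inside, to be evaluated for each factorization separately.
    ≡⟨ ∑-swap (λ k (as , bs) → H (+ d - + (2 * k)) (reweight m as) ℚ.* E² k (reweight m bs))
         (upTo (suc d)) (factorizations m) ⟩
  ∑ (List.map (λ (as , bs) → ∑ (List.map (λ k →
        H (+ d - + (2 * k)) (reweight m as) ℚ.* E² k (reweight m bs)) (upTo (suc d))))
      (factorizations m))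
    -- The summands need to agree only at listed pairs, whose degrees add up to that of `m`; the
    -- degree test thus becomes a constant factor.
    ≡⟨ cong ∑ (map-cong-local (All.map (λ {(as , bs)} eq →
         trans (∑-H*E² d (reweight m as) (reweight m bs))
               (cong (λ n → ⟦ n ≡ᵇ d ⟧ ℚ.* W (reweight m bs)) eq))
         (factorizations-degree m))) ⟩
  ∑ (List.map (λ (as , bs) → ⟦ degree m ≡ᵇ d ⟧ ℚ.* W (reweight m bs)) (factorizations m))
    ≡⟨ ∑-*ˡ ⟦ degree m ≡ᵇ d ⟧ _ (factorizations m) ⟩
  ⟦ degree m ≡ᵇ d ⟧ ℚ.* ∑ (List.map (λ (as , bs) → W (reweight m bs)) (factorizations m))
    ≡⟨ cong (⟦ degree m ≡ᵇ d ⟧ ℚ.*_) (∑-W m) ⟩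
  ⟦ degree m ≡ᵇ d ⟧ ℚ.* ⟦ does (squareFree? m) ⟧
    -- `E⁺` tests square-freeness before the degree.
    ≡⟨ ℚₚ.*-comm ⟦ degree m ≡ᵇ d ⟧ _ ⟩
  ⟦ does (squareFree? m) ⟧ ℚ.* ⟦ degree m ≡ᵇ d ⟧
    ≡⟨ ⟦⟧-∧ (does (squareFree? m)) _ ⟨
  E⁺ d m ∎)
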